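{- The Element Distinctness function satisfies $\mathrm{bitpdim}(\mathrm{ED}_n)=\Omega\left(\frac{n^2}{(\log n)^2}\right)$.
   Context: Element Distinctness: let $m$ be a power of two and $n=2m\log_2 m$. The function $\mathrm{ED}_n:\{0,1\}^n\times\{0,1\}^n\to\{0,1\}$ takes $2m$ blocks of $2\log_2 m$ bits each, $x_1,\dots,x_m$ (the left part of the input) and $y_1,\dots,y_m$ (the right part), and equals $1$ iff all the $x_i$'s and $y_i$'s take pairwise distinct values when interpreted as integers in $[m^2]$. The asymptotics are as $m\to\infty$. Bitwise decomposable projective dimension: for $f:\{0,1\}^n\times\{0,1\}^n\to\{0,1\}$, $\mathrm{bitpdim}(f)\le d$ if there are subspaces of $\mathbb{F}_2^d$, $\mathcal{C}=\{U_i^a\}_{i\in[n],a\in\{0,1\}}$ and $\mathcal{D}=\{V_j^b\}_{j\in[n],b\in\{0,1\}}$, such that: (1) with $\phi(x)=\mathrm{span}_{1\le i\le n}U_i^{x_i}$ for $x\in\{0,1\}^n$ on the left side and $\phi(y)=\mathrm{span}_{1\le j\le n}V_j^{y_j}$ for $y\in\{0,1\}^n$ on the right side, for all $(x,y)$: $f(x,y)=1$ iff $\phi(x)\cap\phi(y)\neq\{0\}$; (2) each $W\in\mathcal{C}\cup\mathcal{D}$ equals $\mathrm{span}(S')$ for some $S'\subseteq S=\{e_i-e_j: i,j\in[d], i\ne j\}$, where $e_i$ are the standard basis vectors; (3) for all disjoint $S_1,S_2\subseteq[n]\times\{0,1\}$, $\mathrm{span}_{(i,a)\in S_1}U_i^a\cap\mathrm{span}_{(j,b)\in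 S_2}U_j^b=\{0\}$, and likewise for the subspaces $V_j^b$ in $\mathcal{D}$. $\mathrm{bitpdim}(f)$ is the least such $d$. -}

module Defs where

open import Level using (0ℓ)
open import Data.Bool using (Bool; true; false; _xor_)
open import Data.Fin using (Fin; combine; funToFin; _≟_)
open import Data.Fin.Properties using (2↔Bool)
open import Data.List using (tabulate; _++_)
import Data.List.Relation.Unary.Unique.DecPropositional as Unique
open import Data.Nat using (ℕ; _*_; _^_)
open import Data.Product using (Σ; ∃; _×_; _,_)
open import Data.Vec using (Vec; lookup; replicate; zipWith; _[_]≔_)
open import Function using (_⇔_)
open import Function.Bundles using (Inverse)
open import Relation.Binary.PropositionalEquality using (_≡_; _≢_)
open import Relation.Nullary using (¬_; does)
open import Relation.Unary using (Pred; Decidable; _∈_; _⊆_; _≐_; _∩_; _⊥_; ⋃; ｛_｝)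

-- The field 𝔽₂ is Bool with addition _xor_.  Since -1 = 1 and the only scalars
-- are 0 and 1, subtraction is addition, and a set of vectors is a linear
-- subspace as soon as it contains 0 and is closed under addition.

𝔽₂^ : ℕ → Set
𝔽₂^ d = Vec Bool d

𝟎 : ∀ {d} → 𝔽₂^ d
𝟎 = replicate _ false

infixl 6 _⊕_ _⊖_

_⊕_ : ∀ {d} → 𝔽₂^ d → 𝔽₂^ d → 𝔽₂^ d
_⊕_ = zipWith _xor_

_⊖_ : ∀ {d} → 𝔽₂^ d → 𝔽₂^ d → 𝔽₂^ d
_⊖_ = _⊕_

e : ∀ {d} → Fin d → 𝔽₂^ d
e i = 𝟎 [ i ]≔ true

record Subspace (d : ℕ) : Set₁ where
  field
    carrier  : Pred (𝔽₂^ d) 0ℓ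
    𝟎-closed : 𝟎 ∈ carrier
    ⊕-closed : ∀ {u v} → u ∈ carrier → v ∈ carrier → u ⊕ v ∈ carrier

open Subspace public using (carrier)

data Span {d : ℕ} (P : Pred (𝔽₂^ d) 0ℓ) : Pred (𝔽₂^ d) 0ℓ where
  gen  : ∀ {v} → v ∈ P → v ∈ Span P
  zero : 𝟎 ∈ Span P
  add  : ∀ {u v} → u ∈ Span P → v ∈ Span P → u ⊕ v ∈ Span P

EdgeVectors : (d : ℕ) → Pred (𝔽₂^ d) 0ℓ
EdgeVectors d v = Σ (Fin d) λ i → Σ (Fin d) λ j → i ≢ j × v ≡ e i ⊖ e j

-- Subsets of the finite set EdgeVectors d are taken to be decidable, as they
-- all are classically.
SpannedByEdges : ∀ {d} → Subspace d → Set₁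
SpannedByEdges {d} W =
  Σ (Pred (𝔽₂^ d) 0ℓ) λ S′ →
    Decidable S′ × S′ ⊆ EdgeVectors d × carrier W ≐ Span S′

-- A family U maps (i , a) to the subspace U_i^a.
Family : (n d : ℕ) → Set₁
Family n d = Fin n × Bool → Subspace d

φ : ∀ {n d} → Family n d → Vec Bool n → Pred (𝔽₂^ d) 0ℓ
φ {n} U x = Span (⋃ (Fin n) λ i → carrier (U (i , lookup x i)))

SpanOver : ∀ {n d} → Family n d → Pred (Fin n × Bool) 0ℓ → Pred (𝔽₂^ d) 0ℓ
SpanOver U S = Span λ v → ∃ λ p → p ∈ S × v ∈ carrier (U p)

DisjointSpans : ∀ {n d} → Family n d → Set₁
DisjointSpans {n} U =
  (S₁ S₂ : Pred (Fin n × Bool) 0ℓ) → S₁ ⊥ S₂ →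
  SpanOver U S₁ ∩ SpanOver U S₂ ≐ ｛ 𝟎 ｝

-- An inhabitant witnesses bitpdim(f) ≤ d.
record Bitpdim≤ {n : ℕ} (f : Vec Bool n → Vec Bool n → Bool) (d : ℕ) : Set₁ where
  field
    U V        : Family n d
    represents : ∀ x y → f x y ≡ true ⇔ (¬ (φ U x ∩ φ V y ≐ ｛ 𝟎 ｝))
    U-edges    : ∀ p → SpannedByEdges (U p)
    V-edges    : ∀ p → SpannedByEdges (V p)
    U-disjoint : DisjointSpans U
    V-disjoint : DisjointSpans V

-- Element Distinctness is indexed by k = log₂ m, where m = 2 ^ k.  Each side of
-- the input has m blocks of 2 k bits, so n = 2 m log₂ m bits.
EDsize : ℕ → ℕ
EDsize k = 2 ^ k * (2 * k)

-- The i-th block, read in binary as an integer below 2 ^ (2 k) = m ².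
block : ∀ k → Vec Bool (EDsize k) → Fin (2 ^ k) → Fin (2 ^ (2 * k))
block k x i = funToFin λ j → Inverse.from 2↔Bool (lookup x (combine i j))

ED : ∀ k → Vec Bool (EDsize k) → Vec Bool (EDsize k) → Bool
ED k x y = does (unique? (tabulate (block k x) ++ tabulate (block k y)))
  where open Unique (_≟_ {2 ^ (2 * k)}) using (unique?)

{-# OPTIONS --safe #-}
module Submission where

-- Nechiporuk's method.  Let m = 2 ^ k and fix a left block i.  Giving the other
-- left blocks the values (i′ , 0) and the j-th right block the value
-- (j , 1 + g j), where g : [m] → [m - 1], leaves (m - 1) ^ m distinct
-- subfunctions of block i.  With A and B the spans contributed by the other left
-- blocks and by the right side, disjointness makes the subfunction say whether
-- the span of block i meets A + B outside 0.  As A + B is spanned by edges, it is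
-- determined on the span of block i by a partition of the vertices that block
-- touches; these are the endpoints of a basis of r edges, so at most
-- (2 r + 1) ^ (2 r) subfunctions arise.  Hence 2 r ≥ m - 1, and d is at least the
-- sum of the r over all blocks, since the spans of distinct blocks are independent.

open import Defs
open import Data.Nat using (ℕ; _*_; _^_; _≤_)
open import Data.Nat.Logarithm using (⌊log₂_⌋; ⌊log₂⌋-mono-≤; ⌊log₂[2^n]⌋≡n)
open import Data.Product using (Σ)

open import Level using (0ℓ)
open import Data.Bool using (Bool; true; false; _xor_)
import Data.Bool.Properties as Bool
open import Data.Empty using (⊥-elim)
open import Data.Fin as Fin using (Fin; combine; quotient; remainder; funToFin; finToFun)
open import Data.Fin.Properties using (2↔Bool; injective⇒≤; finToFun-funToFin; funToFin-finToFin; sequence;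
  remQuot-combine; combine-injective; toℕ-injective; toℕ-cast; ¬∀⟶∃¬; suc-injective)
open import Data.List as List using (List; []; _∷_; length; _++_; map)
open import Data.List.Membership.Propositional using () renaming (_∈_ to _∈ₗ_)
open import Data.List.Membership.Propositional.Properties using
  (∈-++⁻; ∈-++⁺ʳ; ∈-lookup; ∈-map⁻; ∈-tabulate⁺; ∈-tabulate⁻)
open import Data.List.Properties using (length-map; length-++; length-tabulate)
import Data.List.Properties as List using (tabulate-cong)
open import Data.List.Relation.Unary.AllPairs using ([]; _∷_)
open import Data.List.Relation.Unary.Unique.Propositional using (Unique)
open import Data.List.Relation.Unary.Unique.Propositional.Properties using (++⁺; tabulate⁺; allFin⁺)
import Data.List.Relation.Unary.Unique.DecPropositional as UniqueDec
import Data.List.Relation.Unary.All.Properties as All using (++⁺)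
open import Data.List.Relation.Unary.All as All using (All; []; _∷_)
open import Data.List.Relation.Unary.Any as Any using (here; there)
open import Data.List.Relation.Unary.Any.Properties using (lookup-index)
import Data.List.Membership.DecPropositional as DecMembership
open import Data.Nat using (zero; suc; pred; _+_; _<_; z≤n; s≤s; NonZero)
open import Data.Nat.Solver using (module +-*-Solver)
open import Data.Nat.Properties hiding (suc-injective)
open import Data.Product using (∃; _×_; _,_; proj₁; proj₂)
open import Data.Sum using (inj₁; inj₂)
open import Data.Unit using (⊤)
open import Data.Vec using (Vec; []; _∷_; lookup; tabulate)
open import Data.Vec.Properties using
  (lookup-zipWith; lookup-replicate; lookup∘update′; zipWith-assoc; zipWith-comm; zipWith-identityˡ; zipWith-identityʳ;
  lookup∘tabulate; tabulate-cong; tabulate∘lookup)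
open import Function using (_∘_; mk⇔; Injective; case_of_)
open import Function.Bundles using (Inverse; Equivalence)
open import Relation.Binary.PropositionalEquality
open import Relation.Nullary using (¬_; Dec; yes; no; does; contradiction)
open import Relation.Nullary.Decidable using (does-⇔; decidable-stable; dec-true; dec-false; ¬¬-excluded-middle)
open import Relation.Nullary.Negation using (¬¬-Monad)
import Effect.Monad
open import Relation.Unary using (Pred; _∈_; _∉_; _⊆_; _∩_; _∪_; _≐_; ｛_｝; ⋃)

-- Vectors over 𝔽₂

private variable
  d n : ℕ
  u v : 𝔽₂^ d

⊕-comm : (u v : 𝔽₂^ d) → u ⊕ v ≡ v ⊕ u
⊕-comm = zipWith-comm Bool.xor-comm

⊕-assoc : (u v w : 𝔽₂^ d) → (u ⊕ v) ⊕ w ≡ u ⊕ (v ⊕ w)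
⊕-assoc = zipWith-assoc Bool.xor-assoc

⊕-identityˡ : (v : 𝔽₂^ d) → 𝟎 ⊕ v ≡ v
⊕-identityˡ = zipWith-identityˡ Bool.xor-identityˡ

⊕-identityʳ : (v : 𝔽₂^ d) → v ⊕ 𝟎 ≡ v
⊕-identityʳ = zipWith-identityʳ Bool.xor-identityʳ

⊕-self : (v : 𝔽₂^ d) → v ⊕ v ≡ 𝟎
⊕-self []      = refl
⊕-self (b ∷ v) = cong₂ _∷_ (Bool.xor-same b) (⊕-self v)

⊕-cancelˡ : (u v : 𝔽₂^ d) → u ⊕ (u ⊕ v) ≡ v
⊕-cancelˡ u v = trans (sym (⊕-assoc u u v)) (trans (cong (_⊕ v) (⊕-self u)) (⊕-identityˡ v))

⊕-cancelʳ : (u v : 𝔽₂^ d) → (u ⊕ v) ⊕ v ≡ u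
⊕-cancelʳ u v = trans (⊕-assoc u v v) (trans (cong (u ⊕_) (⊕-self v)) (⊕-identityʳ u))

⊕-interchange : (a b c d : 𝔽₂^ n) → (a ⊕ b) ⊕ (c ⊕ d) ≡ (a ⊕ c) ⊕ (b ⊕ d)
⊕-interchange a b c d = begin
  (a ⊕ b) ⊕ (c ⊕ d) ≡⟨ ⊕-assoc a b (c ⊕ d) ⟩
  a ⊕ (b ⊕ (c ⊕ d)) ≡⟨ cong (a ⊕_) (⊕-assoc b c d) ⟨
  a ⊕ ((b ⊕ c) ⊕ d) ≡⟨ cong (λ t → a ⊕ (t ⊕ d)) (⊕-comm b c) ⟩
  a ⊕ ((c ⊕ b) ⊕ d) ≡⟨ cong (a ⊕_) (⊕-assoc c b d) ⟩
  a ⊕ (c ⊕ (b ⊕ d)) ≡⟨ ⊕-assoc a c (b ⊕ d) ⟨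
  (a ⊕ c) ⊕ (b ⊕ d) ∎
  where open ≡-Reasoning

edge : Fin d × Fin d → 𝔽₂^ d
edge (a , b) = e a ⊕ e b

-- Spans

private variable
  P Q : Pred (𝔽₂^ d) 0ℓ

span-bind : P ⊆ Span Q → Span P ⊆ Span Q
span-bind P⊆Q (gen p)   = P⊆Q p
span-bind P⊆Q zero      = zero
span-bind P⊆Q (add p q) = add (span-bind P⊆Q p) (span-bind P⊆Q q)

span-mono : P ⊆ Q → Span P ⊆ Span Q
span-mono P⊆Q = span-bind (gen ∘ P⊆Q)

span-∪⁻ : {P Q : Pred (𝔽₂^ d) 0ℓ} → v ∈ Span (P ∪ Q) →
          ∃ λ a → ∃ λ b → a ∈ Span P × b ∈ Span Q × v ≡ a ⊕ b
span-∪⁻ {v = v} (gen (inj₁ p)) = v , 𝟎 , gen p , zero , sym (⊕-identityʳ v)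
span-∪⁻ {v = v} (gen (inj₂ q)) = 𝟎 , v , zero , gen q , sym (⊕-identityˡ v)
span-∪⁻ zero = 𝟎 , 𝟎 , zero , zero , sym (⊕-identityˡ 𝟎)
span-∪⁻ (add p q) with span-∪⁻ p | span-∪⁻ q
... | a , b , a∈ , b∈ , refl | a′ , b′ , a′∈ , b′∈ , refl =
  a ⊕ a′ , b ⊕ b′ , add a∈ a′∈ , add b∈ b′∈ , ⊕-interchange a b a′ b′

span-⊕⁻ˡ : (a b : 𝔽₂^ d) → a ∈ Span P → a ⊕ b ∈ Span P → b ∈ Span P
span-⊕⁻ˡ a b a∈ ab∈ = subst (_∈ Span _) (⊕-cancelˡ a b) (add a∈ ab∈)

span-⊕⁻ʳ : (a b : 𝔽₂^ d) → b ∈ Span P → a ⊕ b ∈ Span P → a ∈ Span P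
span-⊕⁻ʳ a b b∈ ab∈ = subst (_∈ Span _) (⊕-cancelʳ a b) (add ab∈ b∈)

-- Linear maps

scale : Bool → 𝔽₂^ d → 𝔽₂^ d
scale true  v = v
scale false v = 𝟎

scale-xor : ∀ a b (v : 𝔽₂^ d) → scale (a xor b) v ≡ scale a v ⊕ scale b v
scale-xor true  true  v = sym (⊕-self v)
scale-xor true  false v = sym (⊕-identityʳ v)
scale-xor false b     v = sym (⊕-identityˡ _)

-- A linear map given by its images of the basis vectors. It serves both for combinations of a list
-- and for the map onto class representatives in a graph.
linear : (Fin n → 𝔽₂^ d) → 𝔽₂^ n → 𝔽₂^ d
linear r []      = 𝟎
linear r (b ∷ w) = scale b (r Fin.zero) ⊕ linear (r ∘ Fin.suc) w

linear-⊕ : ∀ (r : Fin n → 𝔽₂^ d) u v → linear r (u ⊕ v) ≡ linear r u ⊕ linear r v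
linear-⊕ r []      []      = sym (⊕-self _)
linear-⊕ r (a ∷ u) (b ∷ v) =
  trans (cong₂ _⊕_ (scale-xor a b (r Fin.zero)) (linear-⊕ (r ∘ Fin.suc) u v))
        (⊕-interchange (scale a (r Fin.zero)) (scale b (r Fin.zero)) _ _)

linear-𝟎 : (r : Fin n → 𝔽₂^ d) → linear r 𝟎 ≡ 𝟎
linear-𝟎 {zero}  r = refl
linear-𝟎 {suc n} r = trans (⊕-identityˡ _) (linear-𝟎 (r ∘ Fin.suc))

linear-e : ∀ (r : Fin n → 𝔽₂^ d) a → linear r (e a) ≡ r a
linear-e r Fin.zero    = trans (cong (r Fin.zero ⊕_) (linear-𝟎 (r ∘ Fin.suc))) (⊕-identityʳ _)
linear-e r (Fin.suc a) = trans (⊕-identityˡ _) (linear-e (r ∘ Fin.suc) a)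

linear-false∷ : ∀ (r : Fin n → 𝔽₂^ d) w → linear (λ a → false ∷ r a) w ≡ false ∷ linear r w
linear-false∷ r []          = refl
linear-false∷ r (true  ∷ w) = cong ((false ∷ r Fin.zero) ⊕_) (linear-false∷ (r ∘ Fin.suc) w)
linear-false∷ r (false ∷ w) = cong (𝟎 ⊕_) (linear-false∷ (r ∘ Fin.suc) w)

linear-id : (w : 𝔽₂^ d) → linear e w ≡ w
linear-id []          = refl
linear-id (true  ∷ w) = trans (cong ((true ∷ 𝟎) ⊕_) (linear-false∷ e w)) (cong (true ∷_) (trans (⊕-identityˡ _) (linear-id w)))
linear-id (false ∷ w) = trans (cong (𝟎 ⊕_) (linear-false∷ e w)) (cong (false ∷_) (trans (⊕-identityˡ _) (linear-id w)))

linear-∈ : ∀ {P : Pred (𝔽₂^ d) 0ℓ} (r : Fin n → 𝔽₂^ d) w →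
           (∀ a → lookup w a ≡ true → r a ∈ Span P) → linear r w ∈ Span P
linear-∈ r []          r∈ = zero
linear-∈ r (true  ∷ w) r∈ = add (r∈ Fin.zero refl) (linear-∈ (r ∘ Fin.suc) w (r∈ ∘ Fin.suc))
linear-∈ r (false ∷ w) r∈ = add zero (linear-∈ (r ∘ Fin.suc) w (r∈ ∘ Fin.suc))

-- With `r = e` and `s` the images under a retraction ρ, this turns `w ⊕ ρ w` into the sum of the
-- vectors `e a ⊕ ρ (e a)` over the support of `w`.
linear-⊕-pointwise : ∀ (r s : Fin n → 𝔽₂^ d) w →
                     linear (λ a → r a ⊕ s a) w ≡ linear r w ⊕ linear s w
linear-⊕-pointwise r s []          = sym (⊕-self _)
linear-⊕-pointwise r s (true  ∷ w) =
  trans (cong (r Fin.zero ⊕ s Fin.zero ⊕_) (linear-⊕-pointwise (r ∘ Fin.suc) (s ∘ Fin.suc) w))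
        (⊕-interchange (r Fin.zero) (s Fin.zero) _ _)
linear-⊕-pointwise r s (false ∷ w) =
  trans (⊕-identityˡ _) (trans (linear-⊕-pointwise (r ∘ Fin.suc) (s ∘ Fin.suc) w)
    (sym (cong₂ _⊕_ (⊕-identityˡ _) (⊕-identityˡ _))))

-- Linear independence

-- The recursive form lets a basis grow by one vector at the front, with non-membership in the old
-- span as the only new evidence.
Independent : List (𝔽₂^ d) → Set
Independent []      = ⊤
Independent (v ∷ L) = v ∉ Span (_∈ₗ L) × Independent L

-- If `v = a ⊕ b` with `a` from `L` and `b` from `M`, then `b = v ⊕ a` lies in both spans and
-- vanishes, so `v` would already lie in the span of `L`.
independent-++ : (L M : List (𝔽₂^ d)) → Independent L → Independent M →
                 Span (_∈ₗ L) ∩ Span (_∈ₗ M) ⊆ ｛ 𝟎 ｝ → Independent (L ++ M)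
independent-++ []      M _          indM _     = indM
independent-++ (v ∷ L) M (v∉ , indL) indM L∩M⊆𝟎 =
  v∉L++M , independent-++ L M indL indM (λ (p , q) → L∩M⊆𝟎 (span-mono there p , q))
  where
  v∉L++M : v ∉ Span (_∈ₗ (L ++ M))
  v∉L++M v∈ with span-∪⁻ (span-mono (∈-++⁻ L) v∈)
  ... | a , b , a∈ , b∈ , refl
    with refl ← L∩M⊆𝟎 (span-⊕⁻ˡ a b (span-mono there a∈) (gen (here refl)) , b∈)
    = v∉ (subst (_∈ Span (_∈ₗ L)) (sym (⊕-identityʳ a)) a∈)

combination : (L : List (𝔽₂^ d)) → Vec Bool (length L) → 𝔽₂^ d
combination L = linear (List.lookup L)

combination-∈ : (L : List (𝔽₂^ d)) → ∀ c → combination L c ∈ Span (_∈ₗ L)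
combination-∈ L c = linear-∈ (List.lookup L) c (λ i _ → gen (∈-lookup i))

-- Equal leading coefficients cancel; different ones would express `v` through the rest of the list.
combination-injective : (L : List (𝔽₂^ d)) → Independent L → Injective _≡_ _≡_ (combination L)
combination-injective [] _ {[]} {[]} _ = refl
combination-injective (v ∷ L) (v∉ , ind) {true ∷ c} {true ∷ c′} eq =
  cong (true ∷_) (combination-injective L ind
    (trans (sym (⊕-cancelˡ v _)) (trans (cong (v ⊕_) eq) (⊕-cancelˡ v _))))
combination-injective (v ∷ L) (v∉ , ind) {false ∷ c} {false ∷ c′} eq =
  cong (false ∷_) (combination-injective L ind
    (trans (sym (⊕-identityˡ _)) (trans eq (⊕-identityˡ _))))
combination-injective (v ∷ L) (v∉ , ind) {true ∷ c} {false ∷ c′} eq =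
  ⊥-elim (v∉ (span-⊕⁻ʳ v _ (combination-∈ L c)
    (subst (_∈ Span (_∈ₗ L)) (sym (trans eq (⊕-identityˡ _))) (combination-∈ L c′))))
combination-injective (v ∷ L) (v∉ , ind) {false ∷ c} {true ∷ c′} eq =
  ⊥-elim (v∉ (span-⊕⁻ʳ v _ (combination-∈ L c′)
    (subst (_∈ Span (_∈ₗ L)) (trans (sym (⊕-identityˡ _)) eq) (combination-∈ L c))))

-- Counting

funToFin-cong : ∀ {m n} {f g : Fin m → Fin n} → f ≗ g → funToFin f ≡ funToFin g
funToFin-cong {zero}  f≗g = refl
funToFin-cong {suc m} f≗g = cong₂ combine (f≗g Fin.zero) (funToFin-cong (f≗g ∘ Fin.suc))

toBits : Fin (2 ^ n) → Vec Bool n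
toBits i = tabulate (Inverse.to 2↔Bool ∘ finToFun i)

fromBits : Vec Bool n → Fin (2 ^ n)
fromBits v = funToFin (Inverse.from 2↔Bool ∘ lookup v)

fromBits-toBits : (i : Fin (2 ^ n)) → fromBits {n} (toBits i) ≡ i
fromBits-toBits {n} i = trans (funToFin-cong {n} {g = finToFun {2} {n} i} λ j →
    trans (cong (Inverse.from 2↔Bool) (lookup∘tabulate _ j)) (Inverse.strictlyInverseʳ 2↔Bool _))
  (funToFin-finToFin {n} i)

toBits-fromBits : (v : Vec Bool n) → toBits (fromBits v) ≡ v
toBits-fromBits v = trans (tabulate-cong λ j →
    trans (cong (Inverse.to 2↔Bool) (finToFun-funToFin _ j)) (Inverse.strictlyInverseˡ 2↔Bool _))
  (tabulate∘lookup v)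

Vec-Bool-injective⇒≤ : ∀ {m n} (f : Vec Bool m → Vec Bool n) → Injective _≡_ _≡_ f → m ≤ n
Vec-Bool-injective⇒≤ {m} {n} f f-inj = ≮⇒≥ λ n<m → <⇒≱ (^-monoʳ-< 2 ≤-refl n<m)
  (injective⇒≤ {f = fromBits ∘ f ∘ toBits} λ {i} {j} eq →
    trans (sym (fromBits-toBits {m} i)) (trans (cong (fromBits {m}) (f-inj
      (trans (sym (toBits-fromBits _)) (trans (cong (toBits {n}) eq) (toBits-fromBits _)))))
      (fromBits-toBits {m} j)))

-- Counting over the finite field replaces the exchange lemma: the `2 ^ length L` combinations are
-- distinct among `2 ^ d` vectors.
independent⇒length≤ : (L : List (𝔽₂^ d)) → Independent L → length L ≤ d
independent⇒length≤ L ind = Vec-Bool-injective⇒≤ (combination L) (combination-injective L ind)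

-- Graphs

SupportedOn : List (Fin d) → Pred (𝔽₂^ d) 0ℓ
SupportedOn vs v = ∀ a → lookup v a ≡ true → a ∈ₗ vs

⊕-supportedOn : ∀ {vs} → u ∈ SupportedOn vs → v ∈ SupportedOn vs → u ⊕ v ∈ SupportedOn vs
⊕-supportedOn {u = u} {v = v} u∈ v∈ a eq with lookup u a in equ | lookup v a in eqv
... | true  | _     = u∈ a equ
... | false | true  = v∈ a eqv
... | false | false with () ← trans (sym eq) (trans (lookup-zipWith _xor_ a u v) (cong₂ _xor_ equ eqv))

span-supportedOn : ∀ {vs} → P ⊆ SupportedOn vs → Span P ⊆ SupportedOn vs
span-supportedOn P⊆ (gen p)   = P⊆ p
span-supportedOn P⊆ zero a eq with () ← trans (sym eq) (lookup-replicate a false)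
span-supportedOn {vs = vs} P⊆ (add {u} {v} p q) =
  ⊕-supportedOn {u = u} {v} {vs} (span-supportedOn P⊆ p) (span-supportedOn P⊆ q)

e-supportedOn : ∀ {vs} {a : Fin d} → a ∈ₗ vs → e a ∈ SupportedOn vs
e-supportedOn {a = a} a∈ b eq with b Fin.≟ a
... | yes refl = a∈
... | no b≢a with () ← trans (sym eq) (trans (lookup∘update′ b≢a 𝟎 true) (lookup-replicate b false))

ends : List (Fin d × Fin d) → List (Fin d)
ends []            = []
ends ((a , b) ∷ L) = a ∷ b ∷ ends L

length-ends : (L : List (Fin d × Fin d)) → length (ends L) ≡ 2 * length L
length-ends []      = refl
length-ends (_ ∷ L) = trans (cong (2 +_) (length-ends L)) (sym (*-suc 2 (length L)))

ends-∈ : ∀ {a b : Fin d} {L} → (a , b) ∈ₗ L → a ∈ₗ ends L × b ∈ₗ ends L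
ends-∈ (here refl) = here refl , there (here refl)
ends-∈ (there p)   = let a∈ , b∈ = ends-∈ p in there (there a∈) , there (there b∈)

span-edges-supportedOn : (L : List (Fin d × Fin d)) → Span (_∈ₗ map edge L) ⊆ SupportedOn (ends L)
span-edges-supportedOn L = span-supportedOn λ v∈ → case ∈-map⁻ edge v∈ of λ where
  ((a , b) , p∈ , refl) → let a∈ , b∈ = ends-∈ p∈ in
    ⊕-supportedOn {u = e a} {e b} {ends L} (e-supportedOn a∈) (e-supportedOn b∈)

-- The list holds edges, not vectors, so that its endpoints can be read off. Maximality is doubly
-- negated because it arises from refuting every extension.
MaximalIndependent : Pred (𝔽₂^ d) 0ℓ → Pred (List (Fin d × Fin d)) 0ℓ
MaximalIndependent W L = Independent (map edge L) × All (_∈ W) (map edge L) ×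
  (∀ p → edge p ∈ W → ¬ ¬ (edge p ∈ Span (_∈ₗ map edge L)))

-- Membership in W is undecidable, so L exists only up to double negation; this
-- suffices because the bound to be proved is stable.
maximal-independent : (W : Pred (𝔽₂^ d) 0ℓ) → ¬ ¬ ∃ (MaximalIndependent W)
maximal-independent {d} W = grow (suc d) [] (m≤m+n (suc d) 0) _ []
  where
  grow : ∀ k L → d < k + length L → Independent (map edge L) → All (_∈ W) (map edge L) →
         ¬ ¬ ∃ (MaximalIndependent W)
  -- The counter reaches zero only when `L` is longer than `d`, which independence forbids.
  grow zero    L d< ind all none =
    <⇒≱ d< (subst (_≤ d) (length-map edge L) (independent⇒length≤ (map edge L) ind))
  grow (suc k) L d< ind all none = none (L , ind , all , λ p p∈ p∉ →
    grow k (p ∷ L) (subst (d <_) (sym (+-suc k (length L))) d<) (p∉ , ind) (p∈ ∷ all) none)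

-- Vertex partitions of edge spans

EdgeSpanned : Pred (𝔽₂^ d) 0ℓ → Set
EdgeSpanned {d} T = T ⊆ Span (λ v → (∃ λ p → v ≡ edge p) × v ∈ Span T)

-- The least index shifted by one, or zero if there is none.
first : (Fin n → Bool) → Fin (suc n)
first {zero}  f = Fin.zero
first {suc n} f with f Fin.zero
... | true  = Fin.suc Fin.zero
... | false with first (f ∘ Fin.suc)
...   | Fin.zero  = Fin.zero
...   | Fin.suc t = Fin.suc (Fin.suc t)

first-cong : {f g : Fin n → Bool} → f ≗ g → first f ≡ first g
first-cong {zero}  f≗g = refl
first-cong {suc n} {f} {g} f≗g with f Fin.zero | g Fin.zero | f≗g Fin.zero
... | true  | true  | _ = refl
... | false | false | _ with first (f ∘ Fin.suc) | first (g ∘ Fin.suc) | first-cong (f≗g ∘ Fin.suc)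
...   | Fin.zero  | Fin.zero  | _    = refl
...   | Fin.suc t | Fin.suc t | refl = refl

first-finds : ∀ (f : Fin n → Bool) t → f t ≡ true → ∃ λ s → first f ≡ Fin.suc s × f s ≡ true
first-finds {suc n} f t eq with f Fin.zero in eq₀
... | true = Fin.zero , refl , eq₀
first-finds {suc n} f Fin.zero    eq | false with () ← trans (sym eq) eq₀
first-finds {suc n} f (Fin.suc t) eq | false with first-finds (f ∘ Fin.suc) t eq
... | s , eq′ , fs rewrite eq′ = Fin.suc s , refl , fs

-- Call two vertices equivalent when their edge vector lies in `Span T`. Each class is represented
-- by its first member in `vs`; a class that misses `vs` gets index zero and the vector `𝟎`.
module Representatives (T : Pred (𝔽₂^ d) 0ℓ) (vs : List (Fin d))
  (equiv? : ∀ a t → Dec (edge (a , List.lookup vs t) ∈ Span T)) where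

  index : Fin d → Fin (suc (length vs))
  index a = first (does ∘ equiv? a)

  vertex : Fin (suc (length vs)) → 𝔽₂^ d
  vertex Fin.zero    = 𝟎
  vertex (Fin.suc t) = e (List.lookup vs t)

  -- The partition restricted to `vs`. With `l` vertices there are at most `suc l ^ l` codes, and
  -- these are what gets counted.
  code : Fin (length vs) → Fin (suc (length vs))
  code t = index (List.lookup vs t)

  retraction : 𝔽₂^ d → 𝔽₂^ d
  retraction = linear (vertex ∘ index)

  -- Adding the edge between `a` and `b` exchanges these two endpoints, so both vertices pass the
  -- same equivalence tests and the searches stop at the same place.
  index-cong : ∀ a b → edge (a , b) ∈ Span T → index a ≡ index b
  index-cong a b ab∈ = first-cong λ t → does-⇔ (mk⇔ (to t) (from t)) (equiv? a t) (equiv? b t)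
    where
    c : _ → 𝔽₂^ d
    c t = e (List.lookup vs t)
    to : ∀ t → e a ⊕ c t ∈ Span T → e b ⊕ c t ∈ Span T
    to t ac∈ = subst (_∈ Span T)
      (trans (⊕-interchange (e a) (e b) (e a) (c t)) (trans (cong (_⊕ (e b ⊕ c t)) (⊕-self (e a))) (⊕-identityˡ _)))
      (add ab∈ ac∈)
    from : ∀ t → e b ⊕ c t ∈ Span T → e a ⊕ c t ∈ Span T
    from t bc∈ = subst (_∈ Span T)
      (trans (⊕-assoc (e a) (e b) _) (cong (e a ⊕_) (⊕-cancelˡ (e b) (c t))))
      (add ab∈ bc∈)

  -- A listed vertex is equivalent to itself, so its search succeeds and never falls back on `𝟎`.
  representative-∈ : ∀ t → e (List.lookup vs t) ⊕ vertex (code t) ∈ Span T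
  representative-∈ t
    with s , eq , found ← first-finds (does ∘ equiv? (List.lookup vs t)) t
           (dec-true (equiv? _ t) (subst (_∈ Span T) (sym (⊕-self (e (List.lookup vs t)))) zero))
    rewrite eq with equiv? (List.lookup vs t) s
  ... | yes p = p

  -- Both ends of an edge in `Span T` have the same representative, and the two images cancel.
  -- Generation by edges extends this to all of `Span T`.
  retraction-𝟎 : EdgeSpanned T → ∀ {w} → w ∈ Span T → retraction w ≡ 𝟎
  retraction-𝟎 spanned = kills ∘ span-bind spanned
    where
    kills : Span (λ v → (∃ λ p → v ≡ edge p) × v ∈ Span T) ⊆ (λ v → retraction v ≡ 𝟎)
    kills (gen (((a , b) , refl) , ab∈)) = trans (linear-⊕ _ (e a) (e b))
      (trans (cong₂ _⊕_ (trans (linear-e _ a) (cong vertex (index-cong a b ab∈))) (linear-e _ b))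
             (⊕-self _))
    kills zero              = linear-𝟎 (vertex ∘ index)
    kills (add {u} {v} p q) = trans (linear-⊕ _ u v) (trans (cong₂ _⊕_ (kills p) (kills q)) (⊕-self 𝟎))

module _ {T T′ : Pred (𝔽₂^ d) 0ℓ} (vs : List (Fin d))
  (D  : ∀ a t → Dec (edge (a , List.lookup vs t) ∈ Span T))
  (D′ : ∀ a t → Dec (edge (a , List.lookup vs t) ∈ Span T′)) where

  private
    module A = Representatives T  vs D
    module B = Representatives T′ vs D′

  -- The retraction ρ onto representatives for T kills w, so w is the sum of the
  -- e a ⊕ ρ (e a) over its support, and these vectors are determined by the code.
  span-transport : A.code ≗ B.code → EdgeSpanned T → ∀ {w} → w ∈ SupportedOn vs → w ∈ Span T → w ∈ Span T′
  span-transport code≗ spanned {w} w∈vs w∈T = subst (_∈ Span T′)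
    (trans (linear-⊕-pointwise e (A.vertex ∘ A.index) w)
      (trans (cong₂ _⊕_ (linear-id w) (A.retraction-𝟎 spanned w∈T)) (⊕-identityʳ w)))
    (linear-∈ _ w λ a wa → at (w∈vs a wa))
    where
    at : ∀ {a} → a ∈ₗ vs → e a ⊕ A.vertex (A.index a) ∈ Span T′
    at a∈ rewrite lookup-index a∈ =
      subst (λ t → e (List.lookup vs (Any.index a∈)) ⊕ A.vertex t ∈ Span T′) (sym (code≗ _)) (B.representative-∈ _)

-- Subfunctions

spannedByEdges⇒ : ∀ {T : Pred (𝔽₂^ d) 0ℓ} (W : Subspace d) → SpannedByEdges W → carrier W ⊆ Span T →
                  carrier W ⊆ Span (λ v → (∃ λ p → v ≡ edge p) × v ∈ Span T)
spannedByEdges⇒ W (S , _ , S⊆edges , W⊆ , ⊆W) W⊆T v∈ =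
  span-mono (λ u∈ → let a , b , _ , eq = S⊆edges u∈ in ((a , b) , eq) , W⊆T (⊆W (gen u∈))) (W⊆ v∈)

module _ {n d m} {f : Vec Bool n → Vec Bool n → Bool} (B : Bitpdim≤ f d) (blk : Fin n → Fin m) where
  open Bitpdim≤ B

  -- Both values of every bit are included, so one space contains the contribution of the block for
  -- every input.
  blockSpan : Fin m → Pred (𝔽₂^ d) 0ℓ
  blockSpan i = SpanOver U (λ (p , _) → blk p ≡ i)

  -- A right input `y g` is sent to its partition code on the endpoints of a maximal independent
  -- list of edges in the block span. Equal codes would give equal subfunctions, against
  -- `separated`, so the number of codes bounds `N`.
  subfunction-bound : ∀ i {Z : Set} {N} (base : Vec Bool n) (x : Z → Vec Bool n) (y : Fin N → Vec Bool n) →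
    (∀ z p → blk p ≢ i → lookup (x z) p ≡ lookup base p) →
    (∀ {g h} → g ≢ h → ∃ λ z → f (x z) (y g) ≡ false × f (x z) (y h) ≡ true) →
    ¬ ¬ ∃ λ (L : List (𝔽₂^ d)) → Independent L × All (_∈ blockSpan i) L ×
      N ≤ suc (2 * length L) ^ (2 * length L)
  subfunction-bound i {Z} {N} base x y outside separated none =
    maximal-independent (blockSpan i) λ (L , max@(ind , all , _)) →
    let vs = ends L
        equiv : Fin N → Fin d → Fin (length vs) → Set
        equiv g a t = edge (a , List.lookup vs t) ∈ Span (context g)
    in
    -- There are finitely many equivalence tests and the goal is a negation, so all of them may be
    -- assumed decided at once.
    ¬¬-∀ (λ g → ¬¬-∀ λ a → ¬¬-∀ λ t → ¬¬-excluded-middle {A = equiv g a t}) λ D →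
    let len : length vs ≡ 2 * length (map edge L)
        len = trans (length-ends L) (cong (2 *_) (sym (length-map edge L)))
    in
    none (map edge L , ind , all , subst (λ v → N ≤ suc v ^ v) len
      (injective⇒≤ {f = λ g → funToFin (Representatives.code _ vs (D g))} (same-code L max D)))
    where
    ¬¬-∀ : ∀ {k} {P : Fin k → Set} → (∀ i → ¬ ¬ P i) → ¬ ¬ (∀ i → P i)
    ¬¬-∀ = sequence (Effect.Monad.RawMonad.rawApplicative ¬¬-Monad)

    left : Pred (𝔽₂^ d) 0ℓ
    left v = ∃ λ p → blk p ≢ i × v ∈ carrier (U (p , lookup base p))

    right : Fin N → Pred (𝔽₂^ d) 0ℓ
    right g = ⋃ (Fin n) λ j → carrier (V (j , lookup (y g) j))

    own : Z → Pred (𝔽₂^ d) 0ℓ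
    own z v = ∃ λ p → blk p ≡ i × v ∈ carrier (U (p , lookup (x z) p))

    -- Generators of `A + B`. The part `A` comes from `base` alone, since the inputs `x z` agree
    -- with it outside block `i`.
    context : Fin N → Pred (𝔽₂^ d) 0ℓ
    context g = left ∪ right g

    context-edges : ∀ g → EdgeSpanned (context g)
    context-edges g (inj₁ (p , p∉ , v∈)) = spannedByEdges⇒ (U _) (U-edges _) (λ u∈ → gen (inj₁ (p , p∉ , u∈))) v∈
    context-edges g (inj₂ (j , v∈))      = spannedByEdges⇒ (V _) (V-edges _) (λ u∈ → gen (inj₂ (j , u∈))) v∈

    φ⊆ : ∀ z → φ U (x z) ⊆ Span (own z ∪ left)
    φ⊆ z = span-mono λ where
      (p , v∈) → case blk p Fin.≟ i of λ where
        (yes p∈) → inj₁ (p , p∈ , v∈)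
        (no  p∉) → inj₂ (p , p∉ , subst (λ b → _ ∈ carrier (U (p , b))) (outside z p p∉) v∈)

    left⊆φ : ∀ z → Span left ⊆ φ U (x z)
    left⊆φ z = span-mono λ (p , p∉ , v∈) → p , subst (λ b → _ ∈ carrier (U (p , b))) (sym (outside z p p∉)) v∈

    own⊆φ : ∀ z → Span (own z) ⊆ φ U (x z)
    own⊆φ z = span-mono λ (p , _ , v∈) → p , v∈

    own⊆blockSpan : ∀ z → Span (own z) ⊆ blockSpan i
    own⊆blockSpan z = span-mono λ (p , p∈ , v∈) → _ , p∈ , v∈

    own∩left : ∀ z {v} → v ∈ Span (own z) → v ∈ Span left → 𝟎 ≡ v
    own∩left z v∈own v∈left = proj₁
      (U-disjoint (λ (p , _) → blk p ≡ i) (λ (p , _) → blk p ≢ i) (λ (p∈ , p∉) → p∉ p∈))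
      (own⊆blockSpan z v∈own , span-mono (λ (p , p∉ , v∈) → _ , p∉ , v∈) v∈left)

    -- `represents` turns only the failure of triviality into a value of `f`, hence the double
    -- negation.
    trivial : ∀ {z g} → f (x z) (y g) ≡ false → ¬ ¬ (φ U (x z) ∩ φ V (y g) ≐ ｛ 𝟎 ｝)
    trivial fzg nontrivial with () ← trans (sym fzg) (Equivalence.from (represents _ _) nontrivial)

    -- By maximality every edge in the block span is a combination of edges of `L`, so it touches no
    -- other vertex. List membership is decidable, which removes the double negation.
    blockSpan-supported : ∀ L → MaximalIndependent (blockSpan i) L → blockSpan i ⊆ SupportedOn (ends L)
    blockSpan-supported L (_ , _ , max) w∈ =
      span-supportedOn supported (span-bind (λ (p , p∈ , v∈) →
        spannedByEdges⇒ (U p) (U-edges p) (λ u∈ → gen (p , p∈ , u∈)) v∈) w∈)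
      where
      open DecMembership (Fin._≟_ {d}) using (_∈?_)
      supported : (λ v → (∃ λ p → v ≡ edge p) × v ∈ blockSpan i) ⊆ SupportedOn (ends L)
      supported ((p , refl) , p∈) a eq = decidable-stable (a ∈? ends L)
        λ a∉ → max p p∈ λ v∈ → a∉ (span-edges-supportedOn L v∈ a eq)

    same-code : ∀ L → MaximalIndependent (blockSpan i) L →
      (D : ∀ g a t → Dec (edge (a , List.lookup (ends L) t) ∈ Span (context g))) → ∀ {g h} →
      funToFin (Representatives.code (context g) (ends L) (D g)) ≡
      funToFin (Representatives.code (context h) (ends L) (D h)) → g ≡ h
    same-code L max D {g} {h} eq = decidable-stable (g Fin.≟ h) λ g≢h →
      let z  , fg , fh = separated g≢h
          -- Separating in the other order gives an input where `h` yields `false`; it shows that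
          -- `A` and the right side of `h` meet only in `𝟎`.
          z₀ , fh₀ , _ = separated (g≢h ∘ sym)
      in trivial fg λ gTrivial → trivial fh₀ λ hTrivial →
         Equivalence.to (represents (x z) (y h)) fh
           ((λ (v∈U , v∈V) → meet z z₀ (proj₁ gTrivial) (proj₁ hTrivial) v∈U v∈V) , λ { refl → zero , zero })
      where
      code≗ : Representatives.code (context h) (ends L) (D h) ≗ Representatives.code (context g) (ends L) (D g)
      code≗ t = trans (sym (finToFun-funToFin _ t))
        (trans (cong (λ c → finToFun c t) (sym eq)) (finToFun-funToFin _ t))

      -- w lies in the span of block i and in A + B_h, hence in A + B_g.
      meet : ∀ z z₀ → φ U (x z) ∩ φ V (y g) ⊆ ｛ 𝟎 ｝ → φ U (x z₀) ∩ φ V (y h) ⊆ ｛ 𝟎 ｝ →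
             ∀ {v} → v ∈ φ U (x z) → v ∈ φ V (y h) → 𝟎 ≡ v
      meet z z₀ gTrivial hTrivial v∈U v∈V
        with w , a , w∈ , a∈ , refl ← span-∪⁻ (φ⊆ z v∈U)
        with a′ , b′ , a′∈ , b′∈ , refl ← span-∪⁻
               (span-transport (ends L) (D h) (D g) code≗ (context-edges h)
                 (blockSpan-supported L max (own⊆blockSpan z w∈))
                 (span-⊕⁻ʳ w a (span-mono inj₁ a∈) (span-mono inj₂ v∈V)))
        -- Since `w = a′ ⊕ b′`, the vector `b′` lies on both sides at `z` and `g`, where `f` is
        -- `false`; so `b′` vanishes and `w = a′` lies in `A`.
        with refl ← gTrivial (span-⊕⁻ˡ a′ b′ (left⊆φ z a′∈) (own⊆φ z w∈) , b′∈)
        with w≡𝟎 ← own∩left z w∈ (subst (_∈ Span left) (sym (⊕-identityʳ a′)) a′∈)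
        with w⊕a≡a ← trans (cong (_⊕ a) (sym w≡𝟎)) (⊕-identityˡ a)
        -- With `w` gone, `v = a` comes from the fixed blocks alone, so the input can be changed to
        -- `z₀`.
        = trans (hTrivial (left⊆φ z₀ a∈ , subst (_∈ φ V (y h)) w⊕a≡a v∈V)) (sym w⊕a≡a)

  -- Distinct blocks use disjoint index sets, so by `U-disjoint` their independent lists concatenate
  -- to an independent list, whose length is at most `d`. The final inequality is decidable, which
  -- discharges the double negations.
  independent-blocks : ∀ c r →
    (∀ i → ¬ ¬ ∃ λ (L : List (𝔽₂^ d)) → Independent L × All (_∈ blockSpan i) L × r ≤ c * length L) →
    m * r ≤ c * d
  independent-blocks c r bases = decidable-stable (m * r ≤? c * d) λ m*r≰ →
    collect (List.allFin m) (allFin⁺ m) λ (M , ind , _ , r≤) →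
      m*r≰ (≤-trans (subst (λ l → l * r ≤ _) (length-tabulate {n = m} (λ i → i)) r≤)
                    (*-monoʳ-≤ c (independent⇒length≤ M ind)))
    where
    collect : ∀ is → Unique is → ¬ ¬ ∃ λ (M : List (𝔽₂^ d)) →
      Independent M × All (_∈ SpanOver U (λ (p , _) → blk p ∈ₗ is)) M × length is * r ≤ c * length M
    collect []       _            none = none ([] , _ , [] , z≤n)
    collect (i ∷ is) (i∉is ∷ uniq) none =
      bases i λ (L , indL , allL , r≤) → collect is uniq λ (M , indM , allM , rs≤) →
      none (L ++ M
        , independent-++ L M indL indM (λ (v∈L , v∈M) →
            proj₁ (U-disjoint (λ (p , _) → blk p ≡ i) (λ (p , _) → blk p ∈ₗ is)
                    (λ (p≡i , p∈is) → All.lookup i∉is p∈is (sym p≡i)))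
              (span-bind (All.lookup allL) v∈L , span-bind (All.lookup allM) v∈M))
        , All.++⁺ (All.map (span-mono (λ (p , p≡i , v∈) → p , here p≡i , v∈)) allL)
                  (All.map (span-mono (λ (p , p∈ , v∈) → p , there p∈ , v∈)) allM)
        , subst (r + length is * r ≤_)
            (trans (sym (*-distribˡ-+ c (length L) (length M))) (cong (c *_) (sym (length-++ L))))
            (+-mono-≤ r≤ rs≤))

-- Element distinctness

-- If `l < q`, then `suc l ^ l ≤ q ^ l < q ^ suc q`.
^-bound⇒≤ : ∀ q l → 1 < q → q ^ suc q ≤ suc l ^ l → q ≤ l
^-bound⇒≤ q l 1<q bound = ≮⇒≥ λ l<q → <⇒≱
  (<-≤-trans (s≤s (^-monoˡ-≤ l l<q)) (^-monoʳ-< q 1<q (m<n⇒m<1+n l<q))) bound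

module _ (k : ℕ) where
  open UniqueDec (Fin._≟_ {2 ^ (2 * k)}) using (unique?)

  private
    Value = Fin (2 ^ (2 * k))

  blockIndex : Fin (EDsize k) → Fin (2 ^ k)
  blockIndex = quotient {2 ^ k} (2 * k)

  fromBlocks : (Fin (2 ^ k) → Value) → Vec Bool (EDsize k)
  fromBlocks X = tabulate λ p → lookup (toBits (X (blockIndex p))) (remainder {2 ^ k} (2 * k) p)

  lookup-fromBlocks : ∀ X Y p → X (blockIndex p) ≡ Y (blockIndex p) →
                      lookup (fromBlocks X) p ≡ lookup (fromBlocks Y) p
  lookup-fromBlocks X Y p eq = trans (lookup∘tabulate _ p)
    (trans (cong (λ a → lookup (toBits {2 * k} a) (remainder {2 ^ k} (2 * k) p)) eq) (sym (lookup∘tabulate _ p)))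

  block-fromBlocks : ∀ X → block k (fromBlocks X) ≗ X
  block-fromBlocks X i = trans
    (funToFin-cong {2 * k} λ j → cong (Inverse.from 2↔Bool) (trans (lookup∘tabulate _ (combine i j))
      (cong (λ (i , j) → lookup (toBits {2 * k} (X i)) j) (remQuot-combine {2 ^ k} {2 * k} i j))))
    (fromBits-toBits {2 * k} (X i))

  values : (X Y : Fin (2 ^ k) → Value) → List Value
  values X Y = List.tabulate X ++ List.tabulate Y

  ED-fromBlocks : ∀ X Y → ED k (fromBlocks X) (fromBlocks Y) ≡ does (unique? (values X Y))
  ED-fromBlocks X Y = cong (does ∘ unique?)
    (cong₂ _++_ (List.tabulate-cong (block-fromBlocks X)) (List.tabulate-cong (block-fromBlocks Y)))

  ED-distinct : ∀ X Y → Injective _≡_ _≡_ X → Injective _≡_ _≡_ Y → (∀ i j → X i ≢ Y j) →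
                ED k (fromBlocks X) (fromBlocks Y) ≡ true
  ED-distinct X Y X-inj Y-inj X≢Y = trans (ED-fromBlocks X Y) (dec-true (unique? _)
    (++⁺ (tabulate⁺ X-inj) (tabulate⁺ Y-inj) λ (v∈X , v∈Y) →
      let i , eqX = ∈-tabulate⁻ v∈X ; j , eqY = ∈-tabulate⁻ v∈Y in X≢Y i j (trans (sym eqX) eqY)))

  ED-collision : ∀ X Y i j → X i ≡ Y j → ED k (fromBlocks X) (fromBlocks Y) ≡ false
  ED-collision X Y i j eq = trans (ED-fromBlocks X Y) (dec-false (unique? _) λ uniq →
    unique-++⇒≢ (List.tabulate X) uniq (∈-tabulate⁺ i) (∈-tabulate⁺ j) eq)
    where
    unique-++⇒≢ : ∀ (xs : List Value) {ys a b} → Unique (xs ++ ys) → a ∈ₗ xs → b ∈ₗ ys → a ≢ b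
    unique-++⇒≢ (_ ∷ xs) (x∉ ∷ uniq) (here refl) b∈ = All.lookup x∉ (∈-++⁺ʳ xs b∈)
    unique-++⇒≢ (_ ∷ xs) (x∉ ∷ uniq) (there a∈)  b∈ = unique-++⇒≢ xs uniq a∈ b∈

  module _ {q} (2^k≡ : 2 ^ k ≡ suc q) where

    -- The `m ²` values are exactly the pairs over `[m]`, with `m = suc q`. Second coordinate zero
    -- is reserved for the fixed left blocks, successors for the right.
    pair : Fin (2 ^ k) → Fin (suc q) → Value
    pair i a = Fin.cast size (combine i a)
      where
      size : 2 ^ k * suc q ≡ 2 ^ (2 * k)
      size = trans (cong (2 ^ k *_) (sym 2^k≡)) (trans (sym (^-distribˡ-+-* 2 k k))
        (cong (λ l → 2 ^ (k + l)) (sym (+-identityʳ k))))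

    pair-injective : ∀ {i j a b} → pair i a ≡ pair j b → i ≡ j × a ≡ b
    pair-injective {i} {j} {a} {b} eq = combine-injective i a j b
      (toℕ-injective (trans (sym (toℕ-cast _ _)) (trans (cong Fin.toℕ eq) (toℕ-cast _ _))))

    leftBlocks : Fin (2 ^ k) → Value → Fin (2 ^ k) → Value
    leftBlocks i z j with j Fin.≟ i
    ... | yes _ = z
    ... | no  _ = pair j Fin.zero

    leftBlocks-at : ∀ i z → leftBlocks i z i ≡ z
    leftBlocks-at i z with i Fin.≟ i
    ... | yes _ = refl
    ... | no  i≢i = contradiction refl i≢i

    leftBlocks-outside : ∀ {i} z {j} → j ≢ i → leftBlocks i z j ≡ pair j Fin.zero
    leftBlocks-outside {i} z {j} j≢i with j Fin.≟ i
    ... | yes j≡i = contradiction j≡i j≢i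
    ... | no  _   = refl

    rightBlocks : Fin (q ^ 2 ^ k) → Fin (2 ^ k) → Value
    rightBlocks g j = pair j (Fin.suc (finToFun {q} {2 ^ k} g j))

    -- Take `j` where the two functions differ and put the `j`-th right block of `g` into block `i`.
    -- It collides under `g`, while under `h` the only right block with first coordinate `j` has
    -- another second coordinate.
    separation : ∀ i {g h} → g ≢ h → ∃ λ z →
      ED k (fromBlocks (leftBlocks i z)) (fromBlocks (rightBlocks g)) ≡ false ×
      ED k (fromBlocks (leftBlocks i z)) (fromBlocks (rightBlocks h)) ≡ true
    separation i {g} {h} g≢h = rightBlocks g j
      , ED-collision (leftBlocks i _) (rightBlocks g) i j (leftBlocks-at i _)
      , ED-distinct (leftBlocks i _) (rightBlocks h) left-injective (λ eq → proj₁ (pair-injective eq)) left≢right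
      where
      G H : Fin (2 ^ k) → Fin q
      G = finToFun {q} {2 ^ k} g
      H = finToFun {q} {2 ^ k} h

      difference : ∃ λ j → G j ≢ H j
      difference = ¬∀⟶∃¬ (2 ^ k) (λ j → G j ≡ H j) (λ j → G j Fin.≟ H j) λ G≗H → g≢h
        (trans (sym (funToFin-finToFin {2 ^ k} {q} g)) (trans (funToFin-cong G≗H) (funToFin-finToFin {2 ^ k} {q} h)))

      j = proj₁ difference

      left-injective : Injective _≡_ _≡_ (leftBlocks i (rightBlocks g j))
      left-injective {a} {b} eq with a Fin.≟ i | b Fin.≟ i
      ... | yes refl | yes refl = refl
      -- Block `i` has a successor as second coordinate, the fixed blocks have zero.
      ... | yes _    | no _ with () ← proj₂ (pair-injective eq)
      ... | no _     | yes _ with () ← proj₂ (pair-injective eq)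
      ... | no _     | no _ = proj₁ (pair-injective eq)

      left≢right : ∀ a b → leftBlocks i (rightBlocks g j) a ≢ rightBlocks h b
      left≢right a b eq with a Fin.≟ i
      ... | no _ with () ← proj₂ (pair-injective eq)
      ... | yes _ with refl , eq′ ← pair-injective eq = proj₂ difference (suc-injective eq′)

    Bitpdim≤⇒ : ∀ {d} → 1 < q → Bitpdim≤ (ED k) d → 2 ^ k * q ≤ 2 * d
    -- The factor `2` counts the ends of each edge: the code bound is in terms of vertices, and it
    -- forces at least `q` of them per block.
    Bitpdim≤⇒ 1<q B = independent-blocks B blockIndex 2 q λ i none →
      subfunction-bound B blockIndex i (fromBlocks λ j → pair j Fin.zero)
        (fromBlocks ∘ leftBlocks i) (fromBlocks ∘ rightBlocks)
        (λ z p p≢i → lookup-fromBlocks (leftBlocks i z) (λ j → pair j Fin.zero) p (leftBlocks-outside z p≢i))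
        (separation i)
        λ (L , ind , all , bound) → none (L , ind , all ,
          ^-bound⇒≤ q (2 * length L) 1<q (subst (λ m → q ^ m ≤ _) 2^k≡ bound))

-- The asymptotic bound

≤-log₂-EDsize : ∀ k .{{_ : NonZero k}} → k ≤ ⌊log₂ EDsize k ⌋
≤-log₂-EDsize k = subst (_≤ ⌊log₂ EDsize k ⌋) (⌊log₂[2^n]⌋≡n k)
  (⌊log₂⌋-mono-≤ (m≤m*n (2 ^ k) (2 * k) {{m*n≢0 2 k}}))

mainTheorem7 : Σ ℕ λ C → Σ ℕ λ m₀ → (∀ (k : ℕ) → m₀ ≤ 2 ^ k →
    ∀ (d : ℕ) → Bitpdim≤ (ED k) d →
    EDsize k ^ 2 ≤ C * (d * ⌊log₂ EDsize k ⌋ ^ 2))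
-- One factor 4 comes from squaring `2 * k`, the other from `m ² ≤ 4 * d`. The threshold `m ≥ 4`
-- ensures `1 < q` for `q = m - 1`.
mainTheorem7 = 16 , 4 , bound
  where
  open ≤-Reasoning
  open +-*-Solver

  bound : ∀ k → 4 ≤ 2 ^ k → ∀ d → Bitpdim≤ (ED k) d → EDsize k ^ 2 ≤ 16 * (d * ⌊log₂ EDsize k ⌋ ^ 2)
  bound zero (s≤s ())
  bound k@(suc _) 4≤2^k d B = begin
    (2 ^ k * (2 * k)) ^ 2             ≡⟨ solve 2 (λ m k → (m :* (con 2 :* k)) :^ 2 := con 4 :* (m :* m :* k :^ 2)) refl (2 ^ k) k ⟩
    4 * (2 ^ k * 2 ^ k * k ^ 2)       ≤⟨ *-monoʳ-≤ 4 (*-mono-≤ m²≤4d (^-monoˡ-≤ 2 (≤-log₂-EDsize k))) ⟩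
    4 * (4 * d * ℓ ^ 2)               ≡⟨ solve 2 (λ d l → con 4 :* (con 4 :* d :* l) := con 16 :* (d :* l)) refl d (ℓ ^ 2) ⟩
    16 * (d * ℓ ^ 2)                  ∎
    where
    ℓ = ⌊log₂ EDsize k ⌋
    q = pred (2 ^ k)

    2^k≡ : 2 ^ k ≡ suc q
    2^k≡ = sym (suc-pred (2 ^ k) {{m^n≢0 2 k}})

    1<q : 1 < q
    1<q = ≤-trans (s≤s (s≤s z≤n)) (pred-mono-≤ 4≤2^k)

    m²≤4d : 2 ^ k * 2 ^ k ≤ 4 * d
    m²≤4d = begin
      2 ^ k * 2 ^ k   ≡⟨ cong (2 ^ k *_) 2^k≡ ⟩
      -- Replacing `m = suc q` by `q + q` costs a factor 2; the other 2 in `4 * d` is from the edge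
      -- ends.
      2 ^ k * suc q   ≤⟨ *-monoʳ-≤ (2 ^ k) (+-monoˡ-≤ q (<⇒≤ 1<q)) ⟩
      2 ^ k * (q + q) ≡⟨ solve 2 (λ m q → m :* (q :+ q) := con 2 :* (m :* q)) refl (2 ^ k) q ⟩
      2 * (2 ^ k * q) ≤⟨ *-monoʳ-≤ 2 (Bitpdim≤⇒ k 2^k≡ 1<q B) ⟩
      2 * (2 * d)     ≡⟨ *-assoc 2 2 d ⟨
      4 * d           ∎
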